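{- (Rice) Let $A\subseteq\omega$ be an infinite c.e. set, $n\ge1$, and let $\theta^{(n)}$ be a quasi-Gödel numbering of $\mathcal S^{(n)}_A$. Let $C\subseteq\mathcal S^{(n)}_A$. Then the index set $\{i\in\omega:\theta^{(n)}_i\in C\}$ is computable if, and only if, $C=\emptyset$ or $C=\mathcal S^{(n)}_A$.
   Context: $\omega$ is the set of natural numbers; $\mathcal R^{(n)}$ is the set of total computable functions $\omega^n\to\omega$. $\langle\cdot,\cdot\rangle:\omega^2\to\omega$ is a computable bijection with $\langle x,y\rangle\ge x,y$, extended by $\langle x\rangle=x$, $\langle x_1,\dots,x_{n+1}\rangle=\langle x_1,\langle x_2,\dots,x_{n+1}\rangle\rangle$. $\mathrm{Anf}^{(n)}_A$ is the set of partial functions from $\omega^n$ to $\omega$ whose domain is either empty or equal to $\{0,\dots,a-1\}^n$ for some $a\in A$, and $\mathcal S^{(n)}_A=\mathcal R^{(n)}\cup\mathrm{Anf}^{(n)}_A$. The extended graph of an $n$-ary partial function $q$ is $\{\langle\langle\vec y\rangle,0\rangle:\vec y\in\omega^n\}\cup\{\langle\langle\vec x\rangle,q(\vec x)+1\rangle:\vec x\in\mathrm{dom}(q)\}$. A numbering of a set $X$ is a surjection $\omega\to X$. A numbering $\theta$ of $\mathcal S^{(n)}_A$ is a quasi-Gödel numbering if: (QGN I) the extended graph of $(i,\vec x)\mapsto\theta_i(\vec x)$ is the range of a function in $\mathcal R^{(1)}$; and (QGN II) for every $k\in\mathcal R^{(2)}$ there is $v\in\mathcal R^{(1)}$ such that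 for all $i\in\omega$, $r\in\mathcal S^{(n)}_A$: if $\{k(i,t):t\in\omega\}$ is the extended graph of $r$, then $r=\theta_{v(i)}$. -}

module Defs where

open import Level using (Level; 0ℓ; _⊔_) renaming (suc to lsuc)
open import Data.Nat using (ℕ; suc; _≤_; _<_)
open import Data.Fin using (Fin)
open import Data.Vec using (Vec; []; _∷_; [_]; lookup)
open import Data.Vec.Relation.Unary.All using (All)
open import Data.Product using (_×_; _,_; ∃; ∃-syntax; uncurry)
open import Data.Sum using (_⊎_)
open import Function using (_⇔_)
open import Function.Definitions using (Bijective)
open import Relation.Nullary using (¬_)
open import Relation.Unary using (Pred; _∈_; _⊆_; _≐_; _∪_; Empty)
open import Relation.Binary.Definitions using (_Respects_)
open import Relation.Binary.PropositionalEquality using (_≡_; trans; sym)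

private
  variable
    m n : ℕ
    ℓ : Level

-- Programs for Kleene's n-ary μ-recursive functions.
data Rec : ℕ → Set where
  zeroᴿ : Rec n
  sucᴿ  : Rec 1
  proj  : Fin n → Rec n
  comp  : Rec m → Vec (Rec n) m → Rec n
  prec  : Rec n → Rec (suc (suc n)) → Rec (suc n)
  mu    : Rec (suc n) → Rec n

infix 4 _[_]⇓_

data _[_]⇓_ : Rec n → Vec ℕ n → ℕ → Set where
  ⇓zero  : {xs : Vec ℕ n} → zeroᴿ [ xs ]⇓ 0
  ⇓suc   : ∀ {x} → sucᴿ [ [ x ] ]⇓ suc x
  ⇓proj  : {i : Fin n} {xs : Vec ℕ n} → proj i [ xs ]⇓ lookup xs i
  ⇓comp  : {f : Rec m} {gs : Vec (Rec n) m} {xs : Vec ℕ n} {ys : Vec ℕ m} {z : ℕ} →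
           (∀ i → lookup gs i [ xs ]⇓ lookup ys i) →
           f [ ys ]⇓ z →
           comp f gs [ xs ]⇓ z
  ⇓prec₀ : {g : Rec n} {h : Rec (suc (suc n))} {xs : Vec ℕ n} {y : ℕ} →
           g [ xs ]⇓ y →
           prec g h [ 0 ∷ xs ]⇓ y
  ⇓precₛ : {g : Rec n} {h : Rec (suc (suc n))} {xs : Vec ℕ n} {k y z : ℕ} →
           prec g h [ k ∷ xs ]⇓ y →
           h [ k ∷ y ∷ xs ]⇓ z →
           prec g h [ suc k ∷ xs ]⇓ z
  ⇓mu    : {f : Rec (suc n)} {xs : Vec ℕ n} {y : ℕ} →
           f [ y ∷ xs ]⇓ 0 →
           (∀ z → z < y → ∃[ w ] f [ z ∷ xs ]⇓ suc w) →
           mu f [ xs ]⇓ y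

𝓡 : ∀ n → Pred (Vec ℕ n → ℕ) 0ℓ
𝓡 n f = ∃[ e ] ∀ xs → e [ xs ]⇓ f xs

ComputableSet : Pred ℕ ℓ → Set ℓ
ComputableSet P = ∃[ χ ] χ ∈ 𝓡 1 ×
  (∀ i → (P i × χ [ i ] ≡ 1) ⊎ (¬ P i × χ [ i ] ≡ 0))

CE : Pred ℕ 0ℓ → Set
CE A = ∃[ e ] A ≐ (λ a → ∃[ y ] e [ [ a ] ]⇓ y)

-- Infinite sets of naturals are expressed positively, as the unbounded ones.
Infinite : Pred ℕ 0ℓ → Set
Infinite A = ∀ b → ∃[ a ] b ≤ a × a ∈ A

-- A partial function is given by its graph and need not have a decidable
-- domain or be computable.  Equality of partial functions is _≈_.
record PartialFn (n : ℕ) : Set₁ where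
  field
    graph      : Vec ℕ n → ℕ → Set
    functional : ∀ {xs y z} → graph xs y → graph xs z → y ≡ z

open PartialFn public

dom : PartialFn n → Pred (Vec ℕ n) 0ℓ
dom q xs = ∃[ y ] graph q xs y

infix 4 _≈_

_≈_ : PartialFn n → PartialFn n → Set
q ≈ r = ∀ xs y → graph q xs y ⇔ graph r xs y

total : (Vec ℕ n → ℕ) → PartialFn n
total f .graph xs y = f xs ≡ y
total f .functional p q = trans (sym p) q

𝓡ₚ : ∀ n → Pred (PartialFn n) 0ℓ
𝓡ₚ n q = ∃[ f ] f ∈ 𝓡 n × q ≈ total f

Anf : Pred ℕ 0ℓ → ∀ n → Pred (PartialFn n) 0ℓ
Anf A n q = Empty (dom q) ⊎ (∃[ a ] a ∈ A × dom q ≐ All (_< a))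

𝓢 : Pred ℕ 0ℓ → ∀ n → Pred (PartialFn n) 0ℓ
𝓢 A n = 𝓡ₚ n ∪ Anf A n

-- C is a subset of X, where partial functions with the same graph count as
-- the same element.
IsSubset : Pred (PartialFn n) ℓ → Pred (PartialFn n) 0ℓ → Set (lsuc 0ℓ ⊔ ℓ)
IsSubset C X = C Respects _≈_ × C ⊆ X

IsNumbering : (ℕ → PartialFn n) → Pred (PartialFn n) 0ℓ → Set₁
IsNumbering θ X = (∀ i → θ i ∈ X) × (∀ q → q ∈ X → ∃[ i ] θ i ≈ q)

universal : (ℕ → PartialFn n) → PartialFn (suc n)
universal θ .graph (i ∷ xs) y = graph (θ i) xs y
universal θ .functional {i ∷ xs} p q = functional (θ i) {xs} p q

binary : (ℕ → ℕ → ℕ) → Vec ℕ 2 → ℕ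
binary f (x ∷ y ∷ []) = f x y

-- Any pairing with these properties may underlie the tuple coding.
record Pairing : Set where
  field
    pair       : ℕ → ℕ → ℕ
    computable : binary pair ∈ 𝓡 2
    bijective  : Bijective _≡_ _≡_ (uncurry pair)
    ≥-left     : ∀ x y → x ≤ pair x y
    ≥-right    : ∀ x y → y ≤ pair x y

module _ (P : Pairing) where
  open Pairing P

  code : Vec ℕ (suc n) → ℕ
  code (x ∷ [])     = x
  code (x ∷ y ∷ ys) = pair x (code (y ∷ ys))

  ExtGraph : PartialFn (suc n) → Pred ℕ 0ℓ
  ExtGraph {n} q z = (∃ λ (ys : Vec ℕ (suc n)) → z ≡ pair (code ys) 0)
                   ⊎ (∃[ xs ] ∃[ v ] graph q xs v × z ≡ pair (code xs) (suc v))

  QGN-I : (ℕ → PartialFn (suc n)) → Set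
  QGN-I θ = ∃[ f ] f ∈ 𝓡 1 ×
    ExtGraph (universal θ) ≐ (λ z → ∃[ t ] f [ t ] ≡ z)

  QGN-II : Pred ℕ 0ℓ → (ℕ → PartialFn (suc n)) → Set₁
  QGN-II {n} A θ = ∀ k → k ∈ 𝓡 2 → ∃[ v ] v ∈ 𝓡 1 ×
    (∀ i r → r ∈ 𝓢 A (suc n) →
       (λ z → ∃[ t ] k (i ∷ t ∷ []) ≡ z) ≐ ExtGraph r →
       r ≈ θ (v [ i ]))

  record IsQuasiGödel (A : Pred ℕ 0ℓ) (θ : ℕ → PartialFn (suc n)) : Set₁ where
    field
      numbering : IsNumbering θ (𝓢 A (suc n))
      qgn-I     : QGN-I θ
      qgn-II    : QGN-II A θ

{-# OPTIONS --safe #-}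
-- Let o be an index of the nowhere defined function and let χ decide the index
-- set.  The set K = {i : θ i (i,0,…,0) = 0} is c.e. by QGN-I, so for each j
-- QGN-II yields a computable v such that θ (v i) is θ j for i ∈ K and nowhere
-- defined otherwise.  The total function g(i,…) = |χ (v i) − χ o| has an index i.
-- If χ j ≠ χ o, then i ∈ K iff g(i,0,…,0) = 0 iff i ∉ K, a contradiction; so χ
-- is constant on indices.  Defining K through θ itself avoids a universal machine.
module Submission where

open import Level using (Level; 0ℓ)
open import Data.Nat using (ℕ; zero; suc; pred; _≤_; _<_; _∸_; ∣_-_∣; _≟_)
open import Data.Nat.Properties
  using (0≢1+n; <⇒≢; ≤-trans; ≤-reflexive; ∣m-n∣≡0⇒m≡n; m≡n⇒∣m-n∣≡0; pred[m∸n]≡m∸[1+n])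
open import Data.Fin using (suc)
open import Data.Fin.Patterns using (0F; 1F; 2F)
open import Data.Vec using (Vec; []; _∷_; [_]; lookup; map; replicate; tabulate)
open import Data.Vec.Properties using (lookup-map; lookup∘tabulate)
open import Data.Vec.Relation.Unary.All using (All; []; _∷_)
open import Data.Vec.Relation.Unary.All.Properties using (lookup⁺)
open import Data.Product using (_×_; _,_; ∃; ∃-syntax; proj₁; proj₂)
open import Data.Sum using (_⊎_; inj₁; inj₂)
open import Data.Empty using (⊥)
open import Function using (_⇔_; mk⇔; Equivalence; _∘_)
open import Function.Construct.Symmetry using (⇔-sym)
open import Relation.Nullary using (¬_; yes; no; contradiction)
open import Relation.Nullary.Decidable using (decidable-stable)
open import Relation.Unary using (Pred; _∈_; _∉_; _⊆_; _≐_; Empty)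
open import Relation.Binary.PropositionalEquality
  using (_≡_; _≢_; refl; sym; trans; cong; cong₂; subst; subst₂)
open import Defs

open Equivalence using (to; from)

private
  variable
    m n : ℕ
    f g h : Vec ℕ n → ℕ

-- Closure properties of the total computable functions.

𝓡-cong : (∀ xs → f xs ≡ g xs) → f ∈ 𝓡 n → g ∈ 𝓡 n
𝓡-cong f≗g (e , e⇓) = e , λ xs → subst (e [ xs ]⇓_) (f≗g xs) (e⇓ xs)

𝓡-lookup : ∀ i → (λ xs → lookup xs i) ∈ 𝓡 n
𝓡-lookup i = proj i , λ _ → ⇓proj

𝓡-suc : (λ xs → suc (lookup xs 0F)) ∈ 𝓡 1
𝓡-suc = sucᴿ , λ { (_ ∷ []) → ⇓suc }

𝓡-comp : {gs : Vec (Vec ℕ n → ℕ) m} → f ∈ 𝓡 m → All (_∈ 𝓡 n) gs →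
         (λ xs → f (map (λ g → g xs) gs)) ∈ 𝓡 n
𝓡-comp {gs = gs} (e , e⇓) gs∈ = comp e (tabulate program) , λ xs → ⇓comp (runs xs) (e⇓ _)
  where
  program = λ i → proj₁ (lookup⁺ gs∈ i)

  runs : ∀ xs i → lookup (tabulate program) i [ xs ]⇓ lookup (map (λ g → g xs) gs) i
  runs xs i = subst₂ (_[ xs ]⇓_) (sym (lookup∘tabulate program i))
                (sym (lookup-map i _ gs)) (proj₂ (lookup⁺ gs∈ i) xs)

𝓡-const : ∀ c → (λ _ → c) ∈ 𝓡 n
𝓡-const zero    = zeroᴿ , λ _ → ⇓zero
𝓡-const (suc c) = 𝓡-comp 𝓡-suc (𝓡-const c ∷ [])

𝓡-prec : g ∈ 𝓡 n → h ∈ 𝓡 (suc (suc n)) →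
         (∀ xs → f (0 ∷ xs) ≡ g xs) →
         (∀ k xs → f (suc k ∷ xs) ≡ h (k ∷ f (k ∷ xs) ∷ xs)) →
         f ∈ 𝓡 (suc n)
𝓡-prec {f = f} (d , d⇓) (e , e⇓) f-zero f-suc = prec d e , λ { (k ∷ xs) → runs k xs }
  where
  runs : ∀ k xs → prec d e [ k ∷ xs ]⇓ f (k ∷ xs)
  runs zero    xs = subst (prec d e [ 0 ∷ xs ]⇓_) (sym (f-zero xs)) (⇓prec₀ (d⇓ xs))
  runs (suc k) xs = subst (prec d e [ suc k ∷ xs ]⇓_) (sym (f-suc k xs))
                      (⇓precₛ (runs k xs) (e⇓ _))

-- The search result `g` is given in advance, so showing it to be the least zero of `f` also settles
-- termination.
𝓡-mu : f ∈ 𝓡 (suc n) →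
       (∀ xs → f (g xs ∷ xs) ≡ 0) →
       (∀ xs y → y < g xs → f (y ∷ xs) ≢ 0) →
       g ∈ 𝓡 n
𝓡-mu {f = f} (e , e⇓) root least =
  mu e , λ xs → ⇓mu (subst (e [ _ ]⇓_) (root xs) (e⇓ _)) (λ y y<g → positive y xs (least xs y y<g))
  where
  positive : ∀ y xs → f (y ∷ xs) ≢ 0 → ∃[ w ] e [ y ∷ xs ]⇓ suc w
  positive y xs f≢0 with f (y ∷ xs) | e⇓ (y ∷ xs)
  ... | zero  | _  = contradiction refl f≢0
  ... | suc w | e⇓ = w , e⇓

ifZero : ℕ → ℕ → ℕ → ℕ
ifZero zero    a b = a
ifZero (suc _) a b = b

𝓡-ifZero : f ∈ 𝓡 n → g ∈ 𝓡 n → h ∈ 𝓡 n → (λ xs → ifZero (f xs) (g xs) (h xs)) ∈ 𝓡 n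
𝓡-ifZero f∈ g∈ h∈ = 𝓡-comp {f = λ xs → ifZero (lookup xs 0F) (lookup xs 1F) (lookup xs 2F)}
  -- The step function sees (k, previous value, a, b), so `suc 2F` selects b.
  (𝓡-prec (𝓡-lookup 0F) (𝓡-lookup (suc 2F)) (λ _ → refl) (λ _ _ → refl))
  (f∈ ∷ g∈ ∷ h∈ ∷ [])

𝓡-pred : (λ xs → pred (lookup xs 0F)) ∈ 𝓡 1
𝓡-pred = 𝓡-prec (𝓡-const 0) (𝓡-lookup 0F) (λ _ → refl) (λ _ _ → refl)

𝓡-∸ : f ∈ 𝓡 n → g ∈ 𝓡 n → (λ xs → f xs ∸ g xs) ∈ 𝓡 n
𝓡-∸ f∈ g∈ = 𝓡-comp {f = λ xs → lookup xs 1F ∸ lookup xs 0F}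
  -- Recursion runs on the first argument, so the subtrahend comes first and each step applies
  -- `pred`.
  (𝓡-prec (𝓡-lookup 0F) (𝓡-comp 𝓡-pred (𝓡-lookup 1F ∷ [])) (λ _ → refl)
    (λ k xs → sym (pred[m∸n]≡m∸[1+n] (lookup xs 0F) k)))
  (g∈ ∷ f∈ ∷ [])

-- At least one of the two truncated differences is 0, and the other is the distance.
ifZero-∸ : ∀ x y → ifZero (x ∸ y) (y ∸ x) (x ∸ y) ≡ ∣ x - y ∣
ifZero-∸ zero    zero    = refl
ifZero-∸ zero    (suc y) = refl
ifZero-∸ (suc x) zero    = refl
ifZero-∸ (suc x) (suc y) = ifZero-∸ x y

𝓡-∣-∣ : f ∈ 𝓡 n → g ∈ 𝓡 n → (λ xs → ∣ f xs - g xs ∣) ∈ 𝓡 n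
𝓡-∣-∣ {f = f} {g = g} f∈ g∈ = 𝓡-cong (λ xs → ifZero-∸ (f xs) (g xs))
  (𝓡-ifZero (𝓡-∸ f∈ g∈) (𝓡-∸ g∈ f∈) (𝓡-∸ f∈ g∈))

ifEqual : ℕ → ℕ → ℕ → ℕ → ℕ
ifEqual x y a b = ifZero ∣ x - y ∣ a b

ifEqual-yes : ∀ {x y} a b → x ≡ y → ifEqual x y a b ≡ a
ifEqual-yes a b x≡y = cong (λ d → ifZero d a b) (m≡n⇒∣m-n∣≡0 x≡y)

ifEqual-no : ∀ {x y} a b → x ≢ y → ifEqual x y a b ≡ b
ifEqual-no {x} {y} a b x≢y with ∣ x - y ∣ in eq
... | zero  = contradiction (∣m-n∣≡0⇒m≡n eq) x≢y
... | suc _ = refl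

-- Computable inverses of the pairing.

module _ (P : Pairing) where
  open Pairing P

  𝓡-pair : f ∈ 𝓡 n → g ∈ 𝓡 n → (λ xs → pair (f xs) (g xs)) ∈ 𝓡 n
  𝓡-pair f∈ g∈ = 𝓡-comp computable (f∈ ∷ g∈ ∷ [])

  -- Surjectivity supplies these without a program; `𝓡-left` and `𝓡-right` obtain one by
  -- minimization.
  left right : ℕ → ℕ
  left  z = proj₁ (proj₁ (proj₂ bijective z))
  right z = proj₂ (proj₁ (proj₂ bijective z))

  pair-left-right : ∀ z → pair (left z) (right z) ≡ z
  pair-left-right z = proj₂ (proj₂ bijective z) refl

  pair-injective : ∀ {x y x′ y′} → pair x y ≡ pair x′ y′ → x ≡ x′ × y ≡ y′
  pair-injective {x} {y} {x′} {y′} eq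
    with refl ← proj₁ bijective {x , y} {x′ , y′} eq = refl , refl

  left-unique : ∀ {x y z} → pair x y ≡ z → left z ≡ x
  left-unique eq = proj₁ (pair-injective (trans (pair-left-right _) (sym eq)))

  right-unique : ∀ {x y z} → pair x y ≡ z → right z ≡ y
  right-unique eq = proj₂ (pair-injective (trans (pair-left-right _) (sym eq)))

  right≤ : ∀ z → right z ≤ z
  right≤ z = subst (right z ≤_) (pair-left-right z) (≥-right _ _)

  -- The y with pair x y ≡ z, or z if there is none.
  partner : ℕ → ℕ → ℕ
  partner x z = ifEqual (left z) x (right z) z

  partner-left : ∀ z → partner (left z) z ≡ right z
  partner-left z = ifEqual-yes {left z} (right z) z refl

  -- Stopping the search for y at y = z makes it total, by ≥-right.
  𝓡-partner : (λ xs → partner (lookup xs 0F) (lookup xs 1F)) ∈ 𝓡 2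
  𝓡-partner = 𝓡-mu {f = λ xs → test (lookup xs 0F) (lookup xs 1F) (lookup xs 2F)}
    (𝓡-ifZero (𝓡-∣-∣ (𝓡-pair (𝓡-lookup 1F) (𝓡-lookup 0F)) (𝓡-lookup 2F))
       (𝓡-const 0) (𝓡-∣-∣ (𝓡-lookup 0F) (𝓡-lookup 2F)))
    (λ xs → root (lookup xs 0F) (lookup xs 1F))
    (λ xs y → least y (lookup xs 0F) (lookup xs 1F))
    where
    test : ℕ → ℕ → ℕ → ℕ
    test y x z = ifEqual (pair x y) z 0 ∣ y - z ∣

    root : ∀ x z → test (partner x z) x z ≡ 0
    root x z with left z ≟ x
    ... | yes refl rewrite ifEqual-yes {left z} (right z) z refl =
      ifEqual-yes 0 _ (pair-left-right z)
    ... | no l≢x rewrite ifEqual-no (right z) z l≢x =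
      trans (ifEqual-no 0 _ (l≢x ∘ left-unique)) (m≡n⇒∣m-n∣≡0 {z} refl)

    partner≤ : ∀ x z → partner x z ≤ z
    partner≤ x z with left z ≟ x
    ... | yes l≡x = subst (_≤ z) (sym (ifEqual-yes (right z) z l≡x)) (right≤ z)
    ... | no l≢x  = ≤-reflexive (ifEqual-no (right z) z l≢x)

    -- A smaller root would be a genuine partner, hence `right z`, or else `z` itself, which bounds
    -- `partner x z`.
    least : ∀ y x z → y < partner x z → test y x z ≢ 0
    least y x z y<p test≡0 with pair x y ≟ z
    ... | yes p≡z = <⇒≢ y<p (sym (trans (ifEqual-yes _ _ (left-unique p≡z)) (right-unique p≡z)))
    ... | no p≢z  = <⇒≢ (≤-trans y<p (partner≤ x z))
      (∣m-n∣≡0⇒m≡n (trans (sym (ifEqual-no 0 _ p≢z)) test≡0))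

  -- The search for a pair is split into two nested ones: with `partner` as the inner search, only
  -- `x = left z` gives `pair x (partner x z) ≡ z`.
  𝓡-left : (λ xs → left (lookup xs 0F)) ∈ 𝓡 1
  𝓡-left = 𝓡-mu
    {f = λ xs → ∣ pair (lookup xs 0F) (partner (lookup xs 0F) (lookup xs 1F)) - lookup xs 1F ∣}
    (𝓡-∣-∣ (𝓡-pair (𝓡-lookup 0F) 𝓡-partner) (𝓡-lookup 1F))
    (λ xs → let z = lookup xs 0F in
      m≡n⇒∣m-n∣≡0 (trans (cong (pair (left z)) (partner-left z)) (pair-left-right z)))
    (λ xs x x<l eq → <⇒≢ x<l (sym (left-unique (∣m-n∣≡0⇒m≡n eq))))

  𝓡-right : (λ xs → right (lookup xs 0F)) ∈ 𝓡 1
  𝓡-right = 𝓡-cong (λ xs → partner-left (lookup xs 0F))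
    (𝓡-comp 𝓡-partner (𝓡-left ∷ 𝓡-lookup 0F ∷ []))

  code-surjective : ∀ c → ∃ λ (xs : Vec ℕ (suc n)) → code P xs ≡ c
  code-surjective {n = zero}  c = [ c ] , refl
  code-surjective {n = suc n} c with code-surjective {n = n} (right c)
  ... | y ∷ ys , eq = left c ∷ y ∷ ys , trans (cong (pair (left c)) eq) (pair-left-right c)

  code-injective : {xs ys : Vec ℕ (suc n)} → code P xs ≡ code P ys → xs ≡ ys
  code-injective {xs = x ∷ []} {y ∷ []} refl = refl
  code-injective {xs = x ∷ _ ∷ _} {y ∷ _ ∷ _} eq with pair-injective eq
  ... | refl , eq′ = cong (x ∷_) (code-injective eq′)

  -- Enumerating the extended graph of a single `θ j`.

  module _ {A : Pred ℕ 0ℓ} {θ : ℕ → PartialFn (suc n)} (qg : IsQuasiGödel P A θ) where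
    open IsQuasiGödel qg

    enum : Vec ℕ 1 → ℕ
    enum = proj₁ qgn-I

    enum∈𝓡 : enum ∈ 𝓡 1
    enum∈𝓡 = proj₁ (proj₂ qgn-I)

    enum-range : ExtGraph P (universal θ) ≐ (λ z → ∃[ t ] enum [ t ] ≡ z)
    enum-range = proj₂ (proj₂ qgn-I)

    -- These entries lie in every extended graph, so they serve as filler when an enumeration has
    -- nothing else to list.
    pair-zero∈ExtGraph : ∀ (q : PartialFn (suc n)) c → pair c 0 ∈ ExtGraph P q
    pair-zero∈ExtGraph q c with code-surjective {n = n} c
    ... | ys , eq = inj₁ (ys , cong (λ c → pair c 0) (sym eq))

    -- An entry of the universal graph codes ((i, c), w); stripping i from those with i = j leaves
    -- the entries of `θ j`.
    section : ℕ → ℕ → ℕ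
    section j t = ifEqual (left (left z)) j (pair (right (left z)) (right z)) (pair 0 0)
      where z = enum [ t ]

    𝓡-section : ∀ j → g ∈ 𝓡 m → (λ xs → section j (g xs)) ∈ 𝓡 m
    𝓡-section j g∈ = 𝓡-ifZero (𝓡-∣-∣ (𝓡-comp 𝓡-left (left-enum ∷ [])) (𝓡-const j))
      (𝓡-pair (𝓡-comp 𝓡-right (left-enum ∷ [])) (𝓡-comp 𝓡-right (enum∘g ∷ [])))
      (𝓡-const _)
      where
      enum∘g    = 𝓡-comp enum∈𝓡 (g∈ ∷ [])
      left-enum = 𝓡-comp 𝓡-left (enum∘g ∷ [])

    section-value : ∀ j {t c w} → enum [ t ] ≡ pair (pair j c) w → section j t ≡ pair c w
    section-value j {t} {c} {w} eq rewrite eq =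
      trans (ifEqual-yes _ _ (left-unique (sym (left-unique refl))))
        (cong₂ pair (right-unique (sym (left-unique refl))) (right-unique refl))

    section-other : ∀ {i j t c w} → enum [ t ] ≡ pair (pair i c) w → i ≢ j →
                    section j t ∈ ExtGraph P (θ j)
    section-other {j = j} eq i≢j = subst (_∈ ExtGraph P (θ j))
      (sym (ifEqual-no _ _ λ l≡j →
        i≢j (trans (sym (left-unique (sym (left-unique (sym eq))))) l≡j)))
      (pair-zero∈ExtGraph (θ j) 0)

    section-sound : ∀ j t → section j t ∈ ExtGraph P (θ j)
    section-sound j t with proj₂ enum-range (t , refl)
    ... | inj₁ (i ∷ y ∷ ys , eq) with i ≟ j
    ...   | yes refl = inj₁ (y ∷ ys , section-value j eq)
    ...   | no i≢j   = section-other eq i≢j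
    section-sound j t | inj₂ (i ∷ y ∷ ys , v , θv , eq) with i ≟ j
    ...   | yes refl = inj₂ (y ∷ ys , v , θv , section-value j eq)
    ...   | no i≢j   = section-other eq i≢j

    section-complete : ∀ j {z} → z ∈ ExtGraph P (θ j) → ∃[ t ] section j t ≡ z
    section-complete j (inj₁ (y ∷ ys , refl)) with proj₁ enum-range (inj₁ (j ∷ y ∷ ys , refl))
    ... | t , eq = t , section-value j eq
    section-complete j (inj₂ (y ∷ ys , v , θv , refl))
      with proj₁ enum-range (inj₂ (j ∷ y ∷ ys , v , θv , refl))
    ... | t , eq = t , section-value j eq

    -- The c.e. diagonal set `K`.

    diagonal : ℕ → Vec ℕ (suc n)
    diagonal i = i ∷ replicate n 0

    K : Pred ℕ 0ℓ
    K i = graph (θ i) (diagonal i) 0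

    -- The entry whose appearance in `enum` witnesses `i ∈ K`; it ends in 1 because the value 0 is
    -- stored as its successor.
    token : ℕ → ℕ
    token i = pair (pair i (code P (diagonal i))) 1

    𝓡-code-diagonal : ∀ n → (λ xs → code P (lookup xs 0F ∷ replicate n 0)) ∈ 𝓡 (suc m)
    𝓡-code-diagonal zero    = 𝓡-lookup 0F
    𝓡-code-diagonal (suc n) = 𝓡-pair (𝓡-lookup 0F) (𝓡-const _)

    𝓡-token : (λ xs → token (lookup xs 0F)) ∈ 𝓡 (suc m)
    𝓡-token = 𝓡-pair (𝓡-pair (𝓡-lookup 0F) (𝓡-code-diagonal n)) (𝓡-const 1)

    token⇒K : ∀ {i t} → enum [ t ] ≡ token i → i ∈ K
    token⇒K {i} {t} eq with proj₂ enum-range (t , eq)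
    -- Filler entries end in 0, whereas a token ends in 1.
    ... | inj₁ (_ , eq′) = contradiction (sym (proj₂ (pair-injective eq′))) 0≢1+n
    ... | inj₂ (_ ∷ y ∷ ys , v , θv , eq′) with pair-injective eq′
    ...   | codes , refl with pair-injective codes
    ...     | refl , codes′ = subst (λ xs → graph (θ i) xs 0) (sym (code-injective codes′)) θv

    K⇒token : ∀ {i} → i ∈ K → ∃[ t ] enum [ t ] ≡ token i
    K⇒token {i} i∈K = proj₁ enum-range (inj₂ (i ∷ diagonal i , 0 , i∈K , refl))

    -- Switching between `θ j` and the nowhere defined function.

    nowhere : PartialFn (suc n)
    nowhere .graph _ _ = ⊥

    -- The stage t codes both a guess left t for the token and an argument right t.
    switch : ℕ → ℕ → ℕ → ℕ
    switch j i t = ifEqual (enum [ left t ]) (token i) (section j (right t)) (pair (right t) 0)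

    𝓡-switch : ∀ j → (λ xs → switch j (lookup xs 0F) (lookup xs 1F)) ∈ 𝓡 2
    𝓡-switch j = 𝓡-ifZero
      (𝓡-∣-∣ (𝓡-comp enum∈𝓡 (𝓡-comp 𝓡-left (𝓡-lookup 1F ∷ []) ∷ [])) 𝓡-token)
      (𝓡-section j right-t) (𝓡-pair right-t (𝓡-const 0))
      where right-t = 𝓡-comp 𝓡-right (𝓡-lookup 1F ∷ [])

    -- One successful guess suffices: `t` combines it with every argument of `section j`, and failed
    -- guesses add only filler.
    switch-in : ∀ j {i} → i ∈ K → (λ z → ∃[ t ] switch j i t ≡ z) ≐ ExtGraph P (θ j)
    switch-in j {i} i∈K = sound , complete
      where
      sound : (λ z → ∃[ t ] switch j i t ≡ z) ⊆ ExtGraph P (θ j)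
      sound (t , refl) with enum [ left t ] ≟ token i
      ... | yes eq rewrite ifEqual-yes (section j (right t)) (pair (right t) 0) eq =
        section-sound j (right t)
      ... | no neq rewrite ifEqual-no (section j (right t)) (pair (right t) 0) neq =
        pair-zero∈ExtGraph (θ j) (right t)

      complete : ExtGraph P (θ j) ⊆ (λ z → ∃[ t ] switch j i t ≡ z)
      complete z∈ with K⇒token i∈K | section-complete j z∈
      ... | a , enum≡token | b , section≡z = pair a b ,
        trans (ifEqual-yes _ _ (trans (cong (λ a → enum [ a ]) (left-unique refl)) enum≡token))
          (trans (cong (section j) (right-unique refl)) section≡z)

    -- No guess succeeds, so only filler appears. It must exhaust the extended graph of `nowhere`,
    -- which is why it is `pair (right t) 0` and not a fixed number.
    switch-out : ∀ j {i} → i ∉ K → (λ z → ∃[ t ] switch j i t ≡ z) ≐ ExtGraph P nowhere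
    switch-out j {i} i∉K = sound , complete
      where
      switch≡ : ∀ t → switch j i t ≡ pair (right t) 0
      switch≡ t = ifEqual-no _ _ (i∉K ∘ token⇒K)

      sound : (λ z → ∃[ t ] switch j i t ≡ z) ⊆ ExtGraph P nowhere
      sound (t , refl) =
        subst (_∈ ExtGraph P nowhere) (sym (switch≡ t)) (pair-zero∈ExtGraph nowhere (right t))

      complete : ExtGraph P nowhere ⊆ (λ z → ∃[ t ] switch j i t ≡ z)
      complete (inj₁ (ys , refl)) = pair 0 (code P ys) ,
        trans (switch≡ _) (cong (λ c → pair c 0) (right-unique refl))

    nowhere∈𝓢 : nowhere ∈ 𝓢 A (suc n)
    nowhere∈𝓢 = inj₂ (inj₁ λ _ ())

    -- The diagonal argument.

    origin : ℕ
    origin = proj₁ (proj₂ numbering nowhere nowhere∈𝓢)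

    θ-origin : θ origin ≈ nowhere
    θ-origin = proj₂ (proj₂ numbering nowhere nowhere∈𝓢)

    -- Two distinct values would let `χ` after `v` separate `K` from its complement computably,
    -- which the diagonal definition of `K` forbids.
    extensional⇒constant : ∀ {χ} → χ ∈ 𝓡 1 → (∀ {i j} → θ i ≈ θ j → χ [ i ] ≡ χ [ j ]) →
                           ∀ j → χ [ j ] ≡ χ [ origin ]
    -- Equality of numbers is stable under double negation, so refuting the inequality is enough and
    -- no decision of `i ∈ K` is required.
    extensional⇒constant {χ} χ∈ extensional j = decidable-stable (_ ≟ _) refute
      where
      QII = qgn-II _ (𝓡-switch j)
      v   = proj₁ QII

      χv-in : ∀ {i} → i ∈ K → χ [ v [ i ] ] ≡ χ [ j ]
      χv-in {i} i∈K = extensional λ xs y →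
        ⇔-sym (proj₂ (proj₂ QII) i (θ j) (proj₁ numbering j) (switch-in j i∈K) xs y)

      χv-out : ∀ {i} → i ∉ K → χ [ v [ i ] ] ≡ χ [ origin ]
      χv-out {i} i∉K = extensional λ xs y →
        let θv = proj₂ (proj₂ QII) i nowhere nowhere∈𝓢 (switch-out j i∉K) xs y
        in mk⇔ (from (θ-origin xs y) ∘ from θv) (to θv ∘ to (θ-origin xs y))

      -- The value is 0 when the first coordinate lies outside `K`; this reverses the condition
      -- defining `K`.
      d : Vec ℕ (suc n) → ℕ
      d xs = ∣ χ [ v [ lookup xs 0F ] ] - χ [ origin ] ∣

      d∈𝓡 : d ∈ 𝓡 (suc n)
      d∈𝓡 = 𝓡-∣-∣ (𝓡-comp χ∈ (𝓡-comp (proj₁ (proj₂ QII)) (𝓡-lookup 0F ∷ []) ∷ [])) (𝓡-const _)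

      index = proj₂ numbering (total d) (inj₁ (d , d∈𝓡 , λ _ _ → mk⇔ (λ p → p) (λ p → p)))
      i     = proj₁ index
      θi≈d  = proj₂ index

      refute : ¬ χ [ j ] ≢ χ [ origin ]
      -- If `i ∈ K`, then `d` vanishes at its own index, so `χ` agrees at `j` and `origin`. Hence
      -- `i ∉ K`, but then `d` vanishes there again and puts `i` into `K`.
      refute χ≢ = i∉K (from (θi≈d (diagonal i) 0) (m≡n⇒∣m-n∣≡0 (χv-out i∉K)))
        where
        i∉K : i ∉ K
        i∉K i∈K = χ≢ (trans (sym (χv-in i∈K)) (∣m-n∣≡0⇒m≡n (to (θi≈d (diagonal i) 0) i∈K)))

-- Triviality of computable index sets.

theorem4p16 : ∀ {ℓ : Level} (P : Pairing) (A : Pred ℕ 0ℓ) → Infinite A → CE A →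
    ∀ (n : ℕ) (θ : ℕ → PartialFn (suc n)) → IsQuasiGödel P A θ →
    ∀ (C : Pred (PartialFn (suc n)) ℓ) → IsSubset C (𝓢 A (suc n)) →
    ComputableSet (λ i → θ i ∈ C) ⇔ (Empty C ⊎ C ≐ 𝓢 A (suc n))
theorem4p16 P A _ _ n θ qg C (C-resp , C⊆𝓢) = mk⇔ trivial computable
  where
  open IsQuasiGödel qg using (numbering)

  respʳ : ∀ {q r : PartialFn (suc n)} → q ≈ r → r ∈ C → q ∈ C
  respʳ q≈r = C-resp (λ xs y → ⇔-sym (q≈r xs y))

  computable : Empty C ⊎ C ≐ 𝓢 A (suc n) → ComputableSet (λ i → θ i ∈ C)
  computable (inj₁ empty)     = (λ _ → 0) , 𝓡-const 0 , λ i → inj₂ (empty (θ i) , refl)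
  computable (inj₂ (_ , 𝓢⊆C)) =
    (λ _ → 1) , 𝓡-const 1 , λ i → inj₁ (𝓢⊆C (proj₁ numbering i) , refl)

  trivial : ComputableSet (λ i → θ i ∈ C) → Empty C ⊎ C ≐ 𝓢 A (suc n)
  -- Since `χ` is constant, its value at `o` alone decides between the two alternatives, and
  -- surjectivity of `θ` carries the answer to every member of `𝓢`.
  trivial (χ , χ∈ , decides) = conclude (decides o)
    where
    o = origin P qg

    extensional : ∀ {i j} → θ i ≈ θ j → χ [ i ] ≡ χ [ j ]
    extensional {i} {j} θi≈θj with decides i | decides j
    ... | inj₁ (_ , p)  | inj₁ (_ , q)  = trans p (sym q)
    ... | inj₁ (∈C , _) | inj₂ (∉C , _) = contradiction (C-resp θi≈θj ∈C) ∉C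
    ... | inj₂ (∉C , _) | inj₁ (∈C , _) = contradiction (respʳ θi≈θj ∈C) ∉C
    ... | inj₂ (_ , p)  | inj₂ (_ , q)  = trans p (sym q)

    constant : ∀ j → χ [ j ] ≡ χ [ o ]
    constant = extensional⇒constant P qg χ∈ extensional

    conclude : (θ o ∈ C × χ [ o ] ≡ 1) ⊎ (θ o ∉ C × χ [ o ] ≡ 0) → Empty C ⊎ C ≐ 𝓢 A (suc n)
    conclude (inj₁ (_ , χo≡1)) = inj₂ (C⊆𝓢 , 𝓢⊆C)
      where
      𝓢⊆C : 𝓢 A (suc n) ⊆ C
      𝓢⊆C {q} q∈𝓢 with proj₂ numbering q q∈𝓢
      ... | j , θj≈q with decides j
      ...   | inj₁ (∈C , _)   = C-resp θj≈q ∈C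
      ...   | inj₂ (_ , χj≡0) = contradiction (trans (sym χj≡0) (trans (constant j) χo≡1)) 0≢1+n
    conclude (inj₂ (_ , χo≡0)) = inj₁ empty
      where
      empty : Empty C
      empty q q∈C with proj₂ numbering q (C⊆𝓢 q∈C)
      ... | j , θj≈q with decides j
      ...   | inj₁ (_ , χj≡1) = 0≢1+n (trans (sym χo≡0) (trans (sym (constant j)) χj≡1))
      ...   | inj₂ (∉C , _)   = ∉C (respʳ θj≈q q∈C)
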